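{- Let $r$ be a constant and let $G$ be any unweighted $K_r$-minor-free graph with $n$ vertices and diameter $\Delta$. Then there is an exact spanning tree cover $\mathcal{F}$ for the shortest-path metric of $G$ consisting of $2^{O(\Delta)}$ trees; that is, every tree in $\mathcal{F}$ is a subgraph of $G$, and for every pair of vertices $u,v$ of $G$ there is a tree $T\in\mathcal{F}$ with $d_T(u,v)=\delta_G(u,v)$.
   Context: $\delta_G$ is the (hop) shortest-path distance in the unweighted graph $G$ and $d_T$ the distance in a tree $T$ (a subgraph of $G$, so $d_T(u,v)\ge\delta_G(u,v)$ whenever $u,v\in V(T)$). The constant in $O(\Delta)$ may depend on $r$. -}

module Defs where

open import Data.Nat using (ℕ; zero; suc; _≤_)
open import Data.Fin using (Fin; zero; suc; inject₁; fromℕ)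
open import Data.Maybe using (Maybe; just)
open import Data.Product using (Σ; ∃; _×_; ∃-syntax)
open import Relation.Nullary using (¬_)
open import Relation.Binary.PropositionalEquality using (_≡_; _≢_)
open import Data.Empty using (⊥)
open import Level using (0ℓ) renaming (suc to lsuc)

record Graph (n : ℕ) : Set₁ where
  field
    Adj     : Fin n → Fin n → Set
    adj-sym : ∀ {u v} → Adj u v → Adj v u
    adj-irr : ∀ u → ¬ Adj u u
open Graph public

IsWalk : {n : ℕ} → (Fin n → Fin n → Set) → (k : ℕ) → (Fin (suc k) → Fin n) → Set
IsWalk E k w = ∀ (i : Fin k) → E (w (inject₁ i)) (w (suc i))

Walk : {n : ℕ} → (Fin n → Fin n → Set) → Fin n → Fin n → ℕ → Set
Walk {n} E u v k =
  Σ (Fin (suc k) → Fin n) λ w → IsWalk E k w × (w zero ≡ u) × (w (fromℕ k) ≡ v)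

Dist : {n : ℕ} → (Fin n → Fin n → Set) → Fin n → Fin n → ℕ → Set
Dist E u v d = Walk E u v d × (∀ m → Walk E u v m → d ≤ m)

Diameter : {n : ℕ} → Graph n → ℕ → Set
Diameter {n} G Δ =
  (∀ u v → ∃[ d ] (Dist (Adj G) u v d × d ≤ Δ)) ×
  (∃[ u ] ∃[ v ] Dist (Adj G) u v Δ)

-- A K_r minor model: branch sets φ⁻¹(just i), i : Fin r, which are nonempty,
-- pairwise disjoint (automatic), induce connected subgraphs, and are pairwise
-- joined by an edge.
KMinor : {n : ℕ} → Graph n → (r : ℕ) → Set
KMinor {n} G r = Σ (Fin n → Maybe (Fin r)) λ φ →
  (∀ i → ∃[ v ] φ v ≡ just i) ×
  (∀ i u v → φ u ≡ just i → φ v ≡ just i →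
     ∃[ k ] Σ (Fin (suc k) → Fin n) λ w →
       IsWalk (Adj G) k w × (w zero ≡ u) × (w (fromℕ k) ≡ v) ×
       (∀ j → φ (w j) ≡ just i)) ×
  (∀ i j → i ≢ j → ∃[ u ] ∃[ v ] (φ u ≡ just i × φ v ≡ just j × Adj G u v))

KMinorFree : {n : ℕ} → Graph n → (r : ℕ) → Set
KMinorFree G r = ¬ KMinor G r

record SubTree {n : ℕ} (G : Graph n) : Set₁ where
  field
    V        : Fin n → Set
    E        : Fin n → Fin n → Set
    E⊆G      : ∀ {u v} → E u v → Adj G u v
    E-sym    : ∀ {u v} → E u v → E v u
    E-V      : ∀ {u v} → E u v → V u
    conn     : ∀ u v → V u → V v → ∃[ k ] Walk E u v k
    acyclic  : ∀ k (w : Fin (suc k) → Fin n) → 3 ≤ k → IsWalk E k w →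
               w zero ≡ w (fromℕ k) →
               (∀ i j → w (inject₁ i) ≡ w (inject₁ j) → i ≡ j) → ⊥
open SubTree public

{-# OPTIONS --safe #-}
module Submission where

-- Peel G recursively.  Inside a connected region C, let H be the union of BFS paths of G[C] that
-- join a root to one neighbour of each previously contracted bag touching C; contracting H to a
-- new bag keeps the bags touching any component of C − H connected and pairwise adjacent, so there
-- are fewer than r of them.  A shortest path of G meets some H for the first time while still
-- inside the corresponding C, and for y on the path in H a BFS tree of the ball of radius Δ around
-- y in G[C] contains a shortest path between its ends.  So it is enough to colour these balls such
-- that balls of equal colour are disjoint: each colour class is then a forest and extends to a
-- spanning tree.  Within one H, colour y by its BFS path and its level modulo 2Δ + 1.  Across
-- different H, a walk of length at most 2Δ to an earlier H passes through bags, with fewer than r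
-- choices at each passage, so fewer than (r + 1)^(2Δ) earlier colours are to be avoided.

open import Defs
open import Data.Nat using (ℕ; zero; suc; _+_; _*_; _^_; _≤_; _<_; z≤n; s≤s; _/_; _%_; _≤?_)
import Data.Nat as ℕ
open import Data.Nat.DivMod using (m≡m%n+[m/n]*n; _mod_; m%n<n)
open import Data.Nat.Properties hiding (_≟_; _≤?_)
open import Data.Nat.Solver using (module +-*-Solver)
open import Data.Empty using (⊥)
open import Data.Fin using (Fin; zero; suc; inject₁; fromℕ; toℕ; combine; remQuot)
open import Data.Fin.Properties using (_≟_; any?; injective⇒≤; toℕ-fromℕ<; remQuot-combine)
open import Data.List using (List; []; _∷_; length; lookup; allFin; cartesianProduct; concatMap; filter)
open import Data.List.Membership.Propositional using (_∈_; _∉_; lose)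
open import Data.List.Membership.Propositional.Properties
  using (∈-allFin; ∈-cartesianProduct⁺; ∈-concatMap⁺; ∈-filter⁺)
open import Data.List.Properties using (length-++; length-tabulate; filter-notAll)
open import Data.List.Relation.Unary.Any as Any using (here; there)
open import Data.List.Relation.Unary.Any.Properties using (lookup-index)
open import Data.Maybe using (Maybe; just; nothing)
open import Data.Maybe.Properties using (just-injective; ≡-dec)
open import Data.Product using (Σ; _×_; _,_; proj₁; proj₂; ∃₂; ∃-syntax; map₂)
open import Data.Sum using (_⊎_; inj₁; inj₂)
open import Data.Unit using (⊤; tt)
open import Function using (_∘_; flip; id)
open import Induction.WellFounded using (Acc; acc)
open import Relation.Binary using (Decidable; Symmetric; tri<; tri≈; tri>)
open import Relation.Binary.Construct.Closure.ReflexiveTransitive using (Star; ε; _◅_; _◅◅_; reverse)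
  renaming (map to mapStar)
open import Relation.Binary.PropositionalEquality
open import Relation.Nullary using (¬_; Dec; yes; no; contradiction)
open import Relation.Nullary.Decidable using (_×-dec_; _⊎-dec_; ¬?; decidable-stable)

-- Paths of given length.

Rel₀ : Set → Set₁
Rel₀ A = A → A → Set

-- The recursive counterpart of `Walk`: it supports induction on the length and can be decided by
-- search over `Fin n`.
Path : {n : ℕ} → Rel₀ (Fin n) → ℕ → Rel₀ (Fin n)
Path R zero    u v = u ≡ v
Path R (suc k) u v = ∃[ x ] (R u x × Path R k x v)

module _ {n : ℕ} where

  path? : {R : Rel₀ (Fin n)} → Decidable R → ∀ k → Decidable (Path R k)
  path? R? zero    u v = u ≟ v
  path? R? (suc k) u v = any? λ x → R? u x ×-dec path? R? k x v

  path-map : {R S : Rel₀ (Fin n)} → (∀ {x y} → R x y → S x y) →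
             ∀ k {u v} → Path R k u v → Path S k u v
  path-map f zero    p           = p
  path-map f (suc k) (x , e , p) = x , f e , path-map f k p

  path-++ : {R : Rel₀ (Fin n)} → ∀ j {k u v w} → Path R j u v → Path R k v w → Path R (j + k) u w
  path-++ zero    refl        q = q
  path-++ (suc j) (x , e , p) q = x , e , path-++ j p q

  path-reverse : {R : Rel₀ (Fin n)} → Symmetric R → ∀ k {u v} → Path R k u v → Path R k v u
  path-reverse R-sym zero    refl        = refl
  path-reverse {R} R-sym (suc k) {u} {v} (x , e , p) =
    subst (λ m → Path R m v u) (+-comm k 1)
      (path-++ k (path-reverse R-sym k p) (u , R-sym e , refl))

  path⇒star : {R : Rel₀ (Fin n)} → ∀ k {u v} → Path R k u v → Star R u v
  path⇒star zero    refl        = ε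
  path⇒star (suc k) (x , e , p) = e ◅ path⇒star k p

  star⇒path : {R : Rel₀ (Fin n)} → ∀ {u v} → Star R u v → ∃[ k ] Path R k u v
  star⇒path ε        = 0 , refl
  star⇒path (e ◅ es) with k , p ← star⇒path es = suc k , _ , e , p

  walk⇒path : {R : Rel₀ (Fin n)} → ∀ k (w : Fin (suc k) → Fin n) →
              IsWalk R k w → Path R k (w zero) (w (fromℕ k))
  walk⇒path zero    w e = refl
  walk⇒path (suc k) w e = w (suc zero) , e zero , walk⇒path k (w ∘ suc) (e ∘ suc)

  walk⇒path′ : ∀ {R : Rel₀ (Fin n)} {k u v} → Walk R u v k → Path R k u v
  walk⇒path′ {k = k} (w , steps , refl , refl) = walk⇒path k w steps

  path⇒walk : {R : Rel₀ (Fin n)} → ∀ k {u v} → Path R k u v → Walk R u v k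
  path⇒walk zero {u} refl = (λ _ → u) , (λ ()) , refl , refl
  path⇒walk {R} (suc k) {u} (x , e , p) with w , steps , start , end ← path⇒walk k p =
      w′ , steps′ , refl , end
    where
    w′ : Fin (suc (suc k)) → Fin n
    w′ zero    = u
    w′ (suc i) = w i
    steps′ : IsWalk R (suc k) w′
    steps′ zero    = subst (R u) (sym start) e
    steps′ (suc i) = steps i

  Induced : Rel₀ (Fin n) → (Fin n → Set) → Rel₀ (Fin n)
  Induced R S u v = R u v × S u × S v

  induced-sym : ∀ {R} → Symmetric R → ∀ {S} → Symmetric (Induced R S)
  induced-sym R-sym (e , su , sv) = R-sym e , sv , su

  -- Acyclicity through bridges, and components through labels.

  Without : Rel₀ (Fin n) → Fin n → Fin n → Rel₀ (Fin n)
  Without E a b x y = E x y × ¬ (x ≡ a × y ≡ b) × ¬ (x ≡ b × y ≡ a)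

  without-sym : ∀ {E a b} → Symmetric E → Symmetric (Without E a b)
  without-sym E-sym (e , f , g) = E-sym e , (λ (p , q) → g (q , p)) , (λ (p , q) → f (q , p))

  -- Acyclicity in the form that every edge is a bridge. It is preserved by joining two components
  -- without any surgery on cycles, and is turned into the absence of cycles only in
  -- `bridges⇒acyclic`.
  Bridges : Rel₀ (Fin n) → Set
  Bridges E = ∀ {a b} → E a b → ¬ Star (Without E a b) a b

  -- A labelling by components makes connectedness decidable by comparing labels.
  Labels : Rel₀ (Fin n) → (Fin n → Fin n) → Set
  Labels E lab = (∀ {x y} → E x y → lab x ≡ lab y) × (∀ {x y} → lab x ≡ lab y → Star E x y)

  AddEdge : Rel₀ (Fin n) → Fin n → Fin n → Rel₀ (Fin n)
  AddEdge E c d x y = E x y ⊎ (x ≡ c × y ≡ d) ⊎ (x ≡ d × y ≡ c)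

  addEdge-sym : ∀ {E c d} → Symmetric E → Symmetric (AddEdge E c d)
  addEdge-sym E-sym (inj₁ e)               = inj₁ (E-sym e)
  addEdge-sym E-sym (inj₂ (inj₁ (p , q))) = inj₂ (inj₂ (q , p))
  addEdge-sym E-sym (inj₂ (inj₂ (p , q))) = inj₂ (inj₁ (q , p))

  module _ (c d : Fin n) where

    relabel : (Fin n → Fin n) → Fin n → Fin n
    relabel lab x with lab x ≟ lab d
    ... | yes _ = lab c
    ... | no  _ = lab x

    relabel-cong : ∀ lab {x y} → lab x ≡ lab y → relabel lab x ≡ relabel lab y
    relabel-cong lab {x} {y} eq with lab x ≟ lab d | lab y ≟ lab d
    ... | yes _ | yes _ = refl
    ... | yes p | no q  = contradiction (trans (sym eq) p) q
    ... | no p  | yes q = contradiction (trans eq q) p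
    ... | no _  | no _  = eq

    relabel-joins : ∀ lab → relabel lab c ≡ relabel lab d
    relabel-joins lab with lab c ≟ lab d | lab d ≟ lab d
    ... | yes _ | yes _ = refl
    ... | yes _ | no q  = contradiction refl q
    ... | no _  | yes _ = refl
    ... | no _  | no q  = contradiction refl q

  module _ {E : Rel₀ (Fin n)} (E-sym : Symmetric E) {c d : Fin n} where

    -- A walk in E − ab + cd from a either stays in E − ab or crosses cd one last time.
    addEdge-without : ∀ {a b x y} →
      Star (Without E a b) a x ⊎
        (Star (Without E a b) a c × Star (Without E a b) d x ⊎
         Star (Without E a b) a d × Star (Without E a b) c x) →
      Star (Without (AddEdge E c d) a b) x y →
      Star (Without E a b) a y ⊎
        (Star (Without E a b) a c × Star (Without E a b) d y ⊎
         Star (Without E a b) a d × Star (Without E a b) c y)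
    addEdge-without h ε = h
    addEdge-without h ((inj₁ e , f) ◅ es) = addEdge-without (extend h) es
      where
      snoc : ∀ {z} → Star _ z _ → Star _ z _
      snoc p = p ◅◅ ((e , f) ◅ ε)
      extend : _ → _
      extend (inj₁ p)              = inj₁ (snoc p)
      extend (inj₂ (inj₁ (p , q))) = inj₂ (inj₁ (p , snoc q))
      extend (inj₂ (inj₂ (p , q))) = inj₂ (inj₂ (p , snoc q))
    addEdge-without h ((inj₂ (inj₁ (refl , refl)) , f) ◅ es) = addEdge-without (cross h) es
      where
      cross : _ → _
      cross (inj₁ p)              = inj₂ (inj₁ (p , ε))
      cross (inj₂ (inj₁ (p , q))) = inj₂ (inj₁ (p , ε))
      cross (inj₂ (inj₂ (p , q))) = inj₁ p
    addEdge-without h ((inj₂ (inj₂ (refl , refl)) , f) ◅ es) = addEdge-without (cross h) es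
      where
      cross : _ → _
      cross (inj₁ p)              = inj₂ (inj₂ (p , ε))
      cross (inj₂ (inj₁ (p , q))) = inj₁ p
      cross (inj₂ (inj₂ (p , q))) = inj₂ (inj₂ (p , ε))

    without-new : ∀ {x y} → Star (Without (AddEdge E c d) c d) x y → Star E x y
    without-new = mapStar λ where
      (inj₁ e , _)              → e
      (inj₂ (inj₁ p) , f , _)   → contradiction p f
      (inj₂ (inj₂ p) , _ , g)   → contradiction p g

    without-new′ : ∀ {x y} → Star (Without (AddEdge E c d) d c) x y → Star E x y
    without-new′ = mapStar λ where
      (inj₁ e , _)              → e
      (inj₂ (inj₁ p) , _ , g)   → contradiction p g
      (inj₂ (inj₂ p) , f , _)   → contradiction p f

    addEdge-bridges : Bridges E → ¬ Star E c d → Bridges (AddEdge E c d)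
    addEdge-bridges br ¬cd {a} {b} (inj₁ ab) p with addEdge-without (inj₁ ε) p
    ... | inj₁ q              = br ab q
    ... | inj₂ (inj₁ (q , s)) =
      ¬cd (reverse E-sym (mapStar proj₁ q) ◅◅ ab ◅ reverse E-sym (mapStar proj₁ s))
    ... | inj₂ (inj₂ (q , s)) = ¬cd (mapStar proj₁ s ◅◅ E-sym ab ◅ mapStar proj₁ q)
    addEdge-bridges br ¬cd (inj₂ (inj₁ (refl , refl))) p = ¬cd (without-new p)
    addEdge-bridges br ¬cd (inj₂ (inj₂ (refl , refl))) p =
      ¬cd (reverse E-sym (without-new′ p))

    addEdge-labels : ∀ {lab} → Labels E lab → Labels (AddEdge E c d) (relabel c d lab)
    addEdge-labels {lab} (sound , complete) = sound′ , complete′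
      where
      old : ∀ {x y} → lab x ≡ lab y → Star (AddEdge E c d) x y
      old eq = mapStar inj₁ (complete eq)
      sound′ : ∀ {x y} → AddEdge E c d x y → relabel c d lab x ≡ relabel c d lab y
      sound′ (inj₁ e)                     = relabel-cong c d lab (sound e)
      sound′ (inj₂ (inj₁ (refl , refl))) = relabel-joins c d lab
      sound′ (inj₂ (inj₂ (refl , refl))) = sym (relabel-joins c d lab)
      complete′ : ∀ {x y} → relabel c d lab x ≡ relabel c d lab y → Star (AddEdge E c d) x y
      complete′ {x} {y} eq with lab x ≟ lab d | lab y ≟ lab d
      ... | yes p | yes q = old (trans p (sym q))
      ... | yes p | no _  = old p ◅◅ inj₂ (inj₂ (refl , refl)) ◅ old eq
      ... | no _  | yes q = old eq ◅◅ inj₂ (inj₁ (refl , refl)) ◅ old (sym q)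
      ... | no _  | no _  = old eq

  -- Greedy extension to spanning forests.

  record Forest (R : Rel₀ (Fin n)) : Set₁ where
    field
      Edge    : Rel₀ (Fin n)
      edge-R  : ∀ {x y} → Edge x y → R x y
      edge-sym : Symmetric Edge
      bridges : Bridges Edge
      lab     : Fin n → Fin n
      labels  : Labels Edge lab

  open Forest

  module _ {R : Rel₀ (Fin n)} (R? : Decidable R) (R-sym : Symmetric R) where

    Extends : Forest R → Forest R → Set
    Extends F F′ = (∀ {x y} → Edge F x y → Edge F′ x y) ×
                   (∀ {x y} → lab F x ≡ lab F y → lab F′ x ≡ lab F′ y)

    extend-edge : (F : Forest R) (c d : Fin n) →
                  ∃[ F′ ] (Extends F F′ × (R c d → lab F′ c ≡ lab F′ d))
    extend-edge F c d with R? c d | lab F c ≟ lab F d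
    ... | no ¬r | _       = F , (id , id) , λ r → contradiction r ¬r
    ... | yes _ | yes eq  = F , (id , id) , λ _ → eq
    ... | yes r | no c≢d = record
        { Edge = AddEdge (Edge F) c d
        ; edge-R = λ where
            (inj₁ e)                     → edge-R F e
            (inj₂ (inj₁ (refl , refl))) → r
            (inj₂ (inj₂ (refl , refl))) → R-sym r
        ; edge-sym = addEdge-sym (edge-sym F)
        ; bridges = addEdge-bridges (edge-sym F) (bridges F) (c≢d ∘ connected⇒same)
        ; lab = relabel c d (lab F)
        ; labels = addEdge-labels (edge-sym F) (labels F)
        } , (inj₁ , relabel-cong c d (lab F)) , λ _ → relabel-joins c d (lab F)
      where
      connected⇒same : ∀ {x y} → Star (Edge F) x y → lab F x ≡ lab F y
      connected⇒same ε        = refl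
      connected⇒same (e ◅ es) = trans (proj₁ (labels F) e) (connected⇒same es)

    extend-edges : (F : Forest R) (ps : List (Fin n × Fin n)) →
      ∃[ F′ ] (Extends F F′ × (∀ {c d} → (c , d) ∈ ps → R c d → lab F′ c ≡ lab F′ d))
    extend-edges F [] = F , (id , id) , λ ()
    extend-edges F ((c , d) ∷ ps)
      with F₁ , (e₁ , l₁) , cd ← extend-edge F c d
      with F₂ , (e₂ , l₂) , rest ← extend-edges F₁ ps =
      F₂ , ((λ e → e₂ (e₁ e)) , (λ e → l₂ (l₁ e))) , λ where
        (here refl) r → l₂ (cd r)
        (there m)   r → rest m r

    -- Kruskal's greedy pass over all pairs. A pair in `R` is passed over only when its labels agree
    -- already, and later steps never separate equal labels.
    spanning : (F : Forest R) → ∃[ F′ ] ((∀ {x y} → Edge F x y → Edge F′ x y) ×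
                                         (∀ {x y} → R x y → lab F′ x ≡ lab F′ y))
    spanning F with F′ , (e , _) , l ← extend-edges F (cartesianProduct (allFin n) (allFin n)) =
      F′ , e , l (∈-cartesianProduct⁺ (∈-allFin _) (∈-allFin _))

    -- Started from the edgeless forest, the greedy pass ends in a spanning forest of `R`, whose
    -- components are those of `R`.
    component-labels : ∃[ lab ] Labels R lab
    component-labels with F , _ , l ← spanning record
        { Edge = λ _ _ → ⊥ ; edge-R = λ () ; edge-sym = λ () ; bridges = λ ()
        ; lab = id ; labels = (λ ()) , λ { refl → ε } } =
      lab F , l , λ eq → mapStar (edge-R F) (proj₂ (labels F) eq)

  -- The rest of a cycle is a detour around its first edge.
  bridges⇒acyclic : ∀ {E : Rel₀ (Fin n)} → Bridges E → Symmetric E →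
    ∀ k (w : Fin (suc k) → Fin n) → 3 ≤ k → IsWalk E k w → w zero ≡ w (fromℕ k) →
    (∀ i j → w (inject₁ i) ≡ w (inject₁ j) → i ≡ j) → ⊥
  bridges⇒acyclic {E} br E-sym (suc (suc (suc k))) w (s≤s (s≤s (s≤s z≤n))) steps closed inj =
    br (steps zero) (reverse (without-sym E-sym)
      (subst (Star _ _) (sym closed) (path⇒star _ (walk⇒path _ (w ∘ suc) avoid))))
    where
    avoid : IsWalk (Without E (w zero) (w (suc zero))) (suc (suc k)) (w ∘ suc)
    avoid i = steps (suc i) , (λ (p , _) → 0≢1+n (cong toℕ (sym (inj (suc i) zero p)))) , λ (p , q) → back i p q
      where
      back : ∀ i → w (suc (inject₁ i)) ≡ w (suc zero) → ¬ (w (suc (suc i)) ≡ w zero)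
      -- The step after the first edge could go straight back to `w zero`; `3 ≤ k` puts its end
      -- among the distinct vertices.
      back zero    _ q with () ← inj (suc (suc zero)) zero q
      back (suc i) p _ with () ← inj (suc (suc i)) (suc zero) p

  -- A rooted forest is given by its (functional) parent relation.
  module _ {P : Rel₀ (Fin n)} (functional : ∀ {u v v′} → P u v → P u v′ → v ≡ v′)
           (well-founded : ∀ u → Acc (flip P) u) where

    ParentEdge : Rel₀ (Fin n)
    ParentEdge x y = P x y ⊎ P y x

    parentEdge-sym : Symmetric ParentEdge
    parentEdge-sym (inj₁ p) = inj₂ p
    parentEdge-sym (inj₂ p) = inj₁ p

    no-loop : ∀ {a b} → Acc (flip P) a → P a b → ¬ Star P b a
    no-loop (acc rs) p ε        = no-loop (rs p) p ε
    no-loop (acc rs) p (q ◅ qs) = no-loop (rs p) q (qs ◅◅ p ◅ ε)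

    -- The descendants of a are closed under all edges but the one from a to its parent.
    descendants-closed : ∀ {a b x y} → P a b → Star P x a → Star (Without ParentEdge a b) x y → Star P y a
    descendants-closed ab s ε                      = s
    descendants-closed ab s ((inj₂ q , _) ◅ es)    = descendants-closed ab (q ◅ s) es
    descendants-closed ab ε ((inj₁ q , f , _) ◅ es) = contradiction (refl , functional q ab) f
    descendants-closed ab (p ◅ s) ((inj₁ q , _) ◅ es) with refl ← functional p q =
      descendants-closed ab s es

    -- If the parent of a vertex could still be reached from it without their edge, the parent would
    -- be its descendant, and the parent steps would close up against well-foundedness.
    parent-bridges : Bridges ParentEdge
    parent-bridges (inj₁ ab) es = no-loop (well-founded _) ab (descendants-closed ab ε es)
    parent-bridges (inj₂ ba) es = no-loop (well-founded _) ba (descendants-closed ba ε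
      (mapStar (λ (e , f , g) → e , g , f) (reverse (without-sym parentEdge-sym) es)))

    parentForest : Decidable P → ∀ {R} → Symmetric R → (∀ {u v} → P u v → R u v) → Forest R
    parentForest P? R-sym P⇒R = record
      { Edge = ParentEdge
      ; edge-R = λ { (inj₁ p) → P⇒R p ; (inj₂ p) → R-sym (P⇒R p) }
      ; edge-sym = parentEdge-sym
      ; bridges = parent-bridges
      ; lab = proj₁ comps
      ; labels = proj₂ comps
      }
      where
      comps : ∃[ lab ] Labels ParentEdge lab
      comps = component-labels (λ x y → P? x y ⊎-dec P? y x) parentEdge-sym

  -- Distances and BFS parents inside a connected region.

  record DistanceTo (R : Rel₀ (Fin n)) (C : Fin n → Set) (y : Fin n) : Set where
    field
      dist      : Fin n → ℕ
      parent    : Fin n → Fin n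
      dist-self : C y → dist y ≡ 0
      dist-zero : ∀ {u} → C y → C u → dist u ≡ 0 → u ≡ y
      dist-suc  : ∀ {u k} → C y → C u → dist u ≡ suc k →
                  R u (parent u) × C (parent u) × dist (parent u) ≡ k
      dist-lip  : ∀ {u v} → C y → C u → C v → R u v → dist u ≤ suc (dist v)

  least : {P : ℕ → Set} → (∀ k → Dec (P k)) → ∀ k → P k → ∃[ m ] (P m × (∀ j → P j → m ≤ j))
  least P? zero    p = 0 , p , λ _ _ → z≤n
  least P? (suc k) p with P? 0
  ... | yes p₀ = 0 , p₀ , λ _ _ → z≤n
  ... | no ¬p₀ with m , pm , min ← least (P? ∘ suc) k p = suc m , pm , λ where
    zero    p₀ → contradiction p₀ ¬p₀
    (suc j) pj → s≤s (min j pj)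

  module _ {R : Rel₀ (Fin n)} (R? : Decidable R) {C : Fin n → Set} (C? : ∀ u → Dec (C u))
           (connected : ∀ {u v} → C u → C v → Star (Induced R C) u v) (y : Fin n) where

    private
      I? : Decidable (Induced R C)
      I? u v = R? u v ×-dec C? u ×-dec C? v

      shortest : ∀ u → ∃[ k ] (C y → C u →
        Path (Induced R C) k u y × (∀ j → Path (Induced R C) j u y → k ≤ j))
      shortest u with C? y | C? u
      -- The laws of `DistanceTo` concern vertices of `C` only, so 0 serves as a default elsewhere.
      ... | no ¬y | _     = 0 , λ cy _ → contradiction cy ¬y
      ... | yes _ | no ¬u = 0 , λ _ cu → contradiction cu ¬u
      ... | yes cy | yes cu with k , p ← star⇒path (connected cu cy)
                            with m , q ← least (λ k → path? I? k u y) k p = m , λ _ _ → q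

      d : Fin n → ℕ
      d u = proj₁ (shortest u)

      next : ∀ u k → d u ≡ suc k → Dec (C y) → Dec (C u) →
             ∃[ v ] (C y → C u → R u v × C v × d v ≡ k)
      next u k eq (no ¬y) _        = u , λ cy _ → contradiction cy ¬y
      next u k eq (yes _) (no ¬u)  = u , λ _ cu → contradiction cu ¬u
      next u k eq (yes cy) (yes cu)
        with p , min ← proj₂ (shortest u) cy cu
        with v , (e , cu , cv) , q ← subst (λ m → Path _ m u y) eq p
        with p′ , min′ ← proj₂ (shortest v) cy cv =
        v , λ _ _ → e , cv , ≤-antisym (min′ k q)
          (≤-pred (subst (_≤ suc (d v)) eq (min (suc (d v)) (v , (e , cu , cv) , p′))))

      step : ∀ u → ∃[ v ] (∀ {k} → C y → C u → d u ≡ suc k → R u v × C v × d v ≡ k)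
      step u = go (d u) refl
        where
        go : ∀ m → d u ≡ m → ∃[ v ] (∀ {k} → C y → C u → d u ≡ suc k → R u v × C v × d v ≡ k)
        -- At distance zero there is no parent, and `u` itself is the default.
        go zero    eq = u , λ _ _ eq′ → contradiction (trans (sym eq) eq′) λ ()
        go (suc k) eq with v , f ← next u k eq (C? y) (C? u) = v , λ cy cu eq′ →
          let e , cv , dv = f cy cu in e , cv , trans dv (suc-injective (trans (sym eq) eq′))

    distanceTo : DistanceTo R C y
    distanceTo = record
      { dist = d
      ; parent = λ u → proj₁ (step u)
      ; dist-self = λ cy → let _ , min = proj₂ (shortest y) cy cy in ≤-antisym (min 0 refl) z≤n
      ; dist-zero = λ {u} cy cu eq →
          let p , _ = proj₂ (shortest u) cy cu in subst (λ m → Path _ m u y) eq p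
      ; dist-suc = λ {u} → proj₂ (step u)
      ; dist-lip = λ {u} {v} cy cu cv e →
          let _ , min = proj₂ (shortest u) cy cu
              p , _   = proj₂ (shortest v) cy cv
          in min (suc (d v)) (v , (e , cu , cv) , p)
      }

-- Residues and counting.

module _ (b : ℕ) {x y : ℕ} (same : x % suc b ≡ y % suc b) where
  open ≤-Reasoning

  %≡⇒apart : x / suc b < y / suc b → b + x < y
  %≡⇒apart q = begin
    suc b + x                               ≡⟨ cong (suc b +_) (m≡m%n+[m/n]*n x (suc b)) ⟩
    suc b + (x % suc b + x / suc b * suc b) ≡⟨ +-assoc (suc b) (x % suc b) _ ⟨
    suc b + x % suc b + x / suc b * suc b   ≡⟨ cong (_+ x / suc b * suc b) (+-comm (suc b) (x % suc b)) ⟩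
    x % suc b + suc b + x / suc b * suc b   ≡⟨ +-assoc (x % suc b) (suc b) _ ⟩
    x % suc b + suc (x / suc b) * suc b     ≤⟨ +-mono-≤ (≤-reflexive same) (*-monoˡ-≤ (suc b) q) ⟩
    y % suc b + y / suc b * suc b           ≡⟨ m≡m%n+[m/n]*n y (suc b) ⟨
    y                                       ∎

  %≡∧/≡⇒≡ : x / suc b ≡ y / suc b → x ≡ y
  %≡∧/≡⇒≡ q = begin-equality
    x                             ≡⟨ m≡m%n+[m/n]*n x (suc b) ⟩
    x % suc b + x / suc b * suc b ≡⟨ cong₂ (λ ρ q → ρ + q * suc b) same q ⟩
    y % suc b + y / suc b * suc b ≡⟨ m≡m%n+[m/n]*n y (suc b) ⟨
    y                             ∎

-- Numbers with equal residues and different quotients are at least `suc b` apart.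
%≡∧close⇒≡ : ∀ b {x y} → x % suc b ≡ y % suc b → x ≤ b + y → y ≤ b + x → x ≡ y
%≡∧close⇒≡ b {x} {y} same x≤ y≤ with <-cmp (x / suc b) (y / suc b)
... | tri≈ _ q _ = %≡∧/≡⇒≡ b same q
... | tri< q _ _ = contradiction y≤ (<⇒≱ (%≡⇒apart b same q))
... | tri> _ _ q = contradiction x≤ (<⇒≱ (%≡⇒apart b (sym same) q))

-- By pigeonhole: if every element occurred, the first positions would embed `Fin m` into the
-- positions of a shorter list.
∉-exists : ∀ {m} (xs : List (Fin m)) → length xs < m → ∃[ x ] x ∉ xs
∉-exists {m} xs short with any? (λ x → ¬? (Any.any? (x ≟_) xs))
... | yes found = found
... | no none = contradiction (injective⇒≤ position-injective) (<⇒≱ short)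
  where
  member : ∀ x → x ∈ xs
  member x = decidable-stable (Any.any? (x ≟_) xs) (λ x∉ → none (x , x∉))
  position-injective : ∀ {x y} → Any.index (member x) ≡ Any.index (member y) → x ≡ y
  position-injective {x} {y} eq =
    trans (lookup-index (member x)) (trans (cong (lookup xs) eq) (sym (lookup-index (member y))))

length-concatMap-≤ : ∀ {A B : Set} (f : A → List B) b → (∀ x → length (f x) ≤ b) →
                     ∀ xs → length (concatMap f xs) ≤ length xs * b
length-concatMap-≤ f b f≤ []       = z≤n
length-concatMap-≤ f b f≤ (x ∷ xs) =
  ≤-trans (≤-reflexive (length-++ (f x))) (+-mono-≤ (f≤ x) (length-concatMap-≤ f b f≤ xs))

-- The recursive clustering and its invariants.

module Clustering {n : ℕ} (G : Graph n) (adj? : Decidable (Adj G)) (r : ℕ)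
                  (minor-free : KMinorFree G r) (δ : ℕ) where

  -- `K` is 2Δ - 1: of a walk of length 2Δ to an earlier separator, at least one step is spent on
  -- reaching a bag. `N` is (r + 1)^(2Δ), more than the r (r + 1)^K colours that can be forbidden.
  Δ K N : ℕ
  Δ = suc δ
  K = δ + suc δ
  N = suc r ^ suc K

  -- The first component keeps different separators apart, the second selects a BFS path within one
  -- separator, and the third is a level modulo 2Δ + 1.
  Color : Set
  Color = Fin N × Fin r × Fin (suc (Δ + Δ))

  private
    A : Rel₀ (Fin n)
    A = Adj G
    A-sym : Symmetric A
    A-sym = adj-sym G
    within-sym : ∀ S → Symmetric (Induced A S)
    within-sym S = induced-sym {R = A} A-sym {S}

  -- The bags φ⁻¹(just i) are contracted earlier separators, now adjacent to the connected set C.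
  -- Near k κ x: some earlier separator of colour κ, chosen inside a region A ⊇ C, is within k
  -- steps of x in A.  forbidden i k lists the colours Near to bag i at distance k.
  record State : Set₁ where
    field
      C : Fin n → Set
      C? : ∀ u → Dec (C u)
      connected : ∀ {u v} → C u → C v → Star (Induced A C) u v
      φ : Fin n → Maybe (Fin r)
      φ-C : ∀ {u} → C u → φ u ≡ nothing
      φ-touch : ∀ {v i} → φ v ≡ just i → ∃₂ λ b c → φ b ≡ just i × C c × A b c
      φ-connected : ∀ {u v i} → φ u ≡ just i → φ v ≡ just i →
                    Star (Induced A (λ x → φ x ≡ just i)) u v
      φ-joined : ∀ {u v i j} → φ u ≡ just i → φ v ≡ just j → i ≢ j →
                 ∃₂ λ a b → φ a ≡ just i × φ b ≡ just j × A a b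
      φ-boundary : ∀ {c y} → C c → ¬ C y → A c y → ∃[ i ] φ y ≡ just i
      Near : ℕ → Fin N → Fin n → Set
      near-mono : ∀ {k κ x} → Near k κ x → Near (suc k) κ x
      near-step : ∀ {k κ x} → C x → Near k κ x → ∃[ j ] (k ≡ suc j × ∃[ y ] (A x y × Near j κ y))
      near-lip : ∀ {k κ x y} → C x → C y → A x y → Near k κ x → Near (suc k) κ y
      forbidden : Fin r → ℕ → List (Fin N)
      forbidden-near : ∀ {b i k κ} → φ b ≡ just i → Near k κ b → κ ∈ forbidden i k
      forbidden-length : ∀ i k → length (forbidden i k) ≤ suc r ^ k

  -- Climbing from both ends to a common ancestor x gives a path of length at most `d` in one
  -- forest.
  Meet : (Color → Rel₀ (Fin n)) → ℕ → Rel₀ (Fin n)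
  Meet P d u v = ∃[ γ ] ∃[ x ] ∃[ a ] ∃[ b ] (Path (P γ) a u x × Path (P γ) b v x × a + b ≤ d)

  -- `parent-far` is the invariant that permits gluing: forests built in this region stay away from
  -- the balls of radius Δ of equally coloured earlier separators.
  record Cover (S : State) : Set₁ where
    open State S
    field
      Parent : Color → Rel₀ (Fin n)
      parent? : ∀ γ → Decidable (Parent γ)
      functional : ∀ {γ u v v′} → Parent γ u v → Parent γ u v′ → v ≡ v′
      well-founded : ∀ γ u → Acc (flip (Parent γ)) u
      parent-adj : ∀ {γ u v} → Parent γ u v → A u v
      parent-C : ∀ {γ u v} → Parent γ u v → C u × C v
      parent-far : ∀ {γ u v} → Parent γ u v → ¬ Near Δ (proj₁ γ) u × ¬ Near Δ (proj₁ γ) v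
      covers : ∀ {d u v} → C u → Path (Induced A C) d u v → d ≤ Δ → Meet Parent d u v

  -- One peeling step.

  module Step (S : State) {root : Fin n} (root∈C : State.C S root) where
    open State S

    Bag : Fin r → Set
    Bag i = ∃[ v ] φ v ≡ just i

    bag? : ∀ i → Dec (Bag i)
    bag? i = any? λ v → ≡-dec _≟_ (φ v) (just i)

    private
      -- If all r indices carried a bag, `φ` itself would be a model of K_r.
      free-index : ∃[ i ] ¬ Bag i
      free-index with any? (λ i → ¬? (bag? i))
      ... | yes found = found
      ... | no full = contradiction minor minor-free
        where
        bag : ∀ i → Bag i
        bag i = decidable-stable (bag? i) (λ e → full (i , e))
        minor : KMinor G r
        minor = φ , bag , connect , join
          where
          connect : ∀ i u v → φ u ≡ just i → φ v ≡ just i →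
                    ∃[ k ] Σ (Fin (suc k) → Fin n) λ w → IsWalk A k w × (w zero ≡ u) ×
                      (w (fromℕ k) ≡ v) × (∀ j → φ (w j) ≡ just i)
          connect i u v pu pv with k , p ← star⇒path (φ-connected pu pv)
                              with w , steps , start , end ← path⇒walk k p =
            k , w , proj₁ ∘ steps , start , end , inside
            where
            inside : ∀ j → φ (w j) ≡ just i
            inside zero    = trans (cong φ start) pu
            inside (suc j) = proj₂ (proj₂ (steps j))
          join : ∀ i j → i ≢ j → ∃[ u ] ∃[ v ] (φ u ≡ just i × φ v ≡ just j × A u v)
          join i j = φ-joined (proj₂ (bag i)) (proj₂ (bag j))

    new : Fin r
    new = proj₁ free-index

    new-free : ∀ {v} → φ v ≢ just new
    new-free e = proj₂ free-index (_ , e)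

    target : ∀ i → ∃[ c ] (C c × (Bag i → ∃[ b ] (φ b ≡ just i × A b c)))
    target i with bag? i
    ... | yes (_ , e) with b , c , eb , cc , bc ← φ-touch e = c , cc , λ _ → b , eb , bc
    -- An index without a bag gets the root, whose spine is a single vertex.
    ... | no empty = root , root∈C , λ bag → contradiction bag empty

    tree : ∀ y → DistanceTo A C y
    tree = distanceTo adj? C? connected

    D : Fin n → Fin n → ℕ
    D y = DistanceTo.dist (tree y)

    par : Fin n → Fin n → Fin n
    par y = DistanceTo.parent (tree y)

    module _ {y : Fin n} where
      open DistanceTo (tree y) public using (dist-self; dist-zero; dist-suc; dist-lip)

    lev : Fin n → ℕ
    lev = D root

    dist-induction : ∀ {y} → C y → (P : ℕ → Fin n → Set) → P 0 y →
      (∀ {k u} → C u → D y u ≡ suc k → P k (par y u) → P (suc k) u) →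
      ∀ {u} → C u → P (D y u) u
    dist-induction {y} cy P base step cu = go _ cu refl
      where
      go : ∀ k {u} → C u → D y u ≡ k → P (D y u) u
      go zero cu eq with refl ← dist-zero cy cu eq = subst (λ k → P k y) (sym eq) base
      go (suc k) {u} cu eq with _ , cv , dv ← dist-suc cy cu eq =
        subst (λ k → P k u) (sym eq) (step cu eq (subst (λ k → P k (par y u)) dv (go k cv dv)))

    dist≤path : ∀ {y} → C y → ∀ k {u} → C u → Path (Induced A C) k u y → D y u ≤ k
    dist≤path cy zero    cu refl = ≤-reflexive (dist-self cy)
    dist≤path cy (suc k) cu (x , (e , _ , cx) , p) =
      ≤-trans (dist-lip cy cu cx e) (s≤s (dist≤path cy k cx p))

    lev-upper : ∀ {y u} → C y → C u → lev u ≤ D y u + lev y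
    lev-upper {y} cy = dist-induction cy (λ k u → lev u ≤ k + lev y) ≤-refl λ cu eq h →
      let e , cv , _ = dist-suc cy cu eq in ≤-trans (dist-lip root∈C cu cv e) (s≤s h)

    lev-lower : ∀ {y u} → C y → C u → lev y ≤ D y u + lev u
    lev-lower {y} cy = dist-induction cy (λ k u → lev y ≤ k + lev u) ≤-refl λ {k} {u} cu eq h →
      let e , cv , _ = dist-suc cy cu eq
      in ≤-trans h (≤-trans (+-monoʳ-≤ k (dist-lip root∈C cv cu (A-sym e)))
                            (≤-reflexive (+-suc k (lev u))))

    -- Choice of a colour for the new separator.

    near-dist : ∀ {y} → C y → ∀ {u} → C u → ∀ {κ k} → Near k κ u → Near (D y u + k) κ y
    near-dist {y} cy = dist-induction cy (λ m u → ∀ {κ k} → Near k κ u → Near (m + k) κ y) id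
      λ {m} cu eq h {κ} {k} near → let e , cv , _ = dist-suc cy cu eq
        in subst (λ j → Near j κ y) (+-suc m k) (h (near-lip cu cv e near))

    near-≤ : ∀ {j k κ x} → j ≤ k → Near j κ x → Near k κ x
    near-≤ {j} {zero}  z≤n near = near
    near-≤ {j} {suc k} j≤k near with m≤n⇒m<n∨m≡n j≤k
    ... | inj₁ j<k  = near-mono (near-≤ (≤-pred j<k) near)
    ... | inj₂ refl = near

    -- A walk from C to an earlier separator leaves C through a bag after at least one step, which
    -- is why the forbidden colours at distance k + 1 come from those of the bags at distance k.
    near-exit : ∀ k {κ x} → C x → Near k κ x →
                ∃[ j ] (k ≡ suc j × ∃₂ λ i y → φ y ≡ just i × Near j κ y)
    near-exit zero cx near with () ← proj₁ (proj₂ (near-step cx near))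
    near-exit (suc k) cx near with _ , refl , y , e , near′ ← near-step cx near with C? y
    ... | no ¬cy with i , yi ← φ-boundary cx ¬cy e = k , refl , i , y , yi , near′
    ... | yes cy with _ , refl , i , z , zi , near″ ← near-exit k cy near′ =
      -- When the bag is reached only after further steps in `C`, the shorter distance found is
      -- weakened back to `k`.
      k , refl , i , z , zi , near-mono near″

    all-forbidden : ℕ → List (Fin N)
    all-forbidden k = concatMap (λ i → forbidden i k) (allFin r)

    all-forbidden-length : ∀ k → length (all-forbidden k) ≤ r * suc r ^ k
    all-forbidden-length k = ≤-trans
      (length-concatMap-≤ _ (suc r ^ k) (λ i → forbidden-length i k) (allFin r))
      (≤-reflexive (cong (_* suc r ^ k) (length-tabulate {A = Fin r} (λ i → i))))

    near⇒forbidden : ∀ {k κ x} → C x → Near k κ x → ∃[ j ] (k ≡ suc j × κ ∈ all-forbidden j)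
    near⇒forbidden cx near with j , refl , i , y , yi , near′ ← near-exit _ cx near =
      j , refl , ∈-concatMap⁺ _ (lose (∈-allFin i) (forbidden-near yi near′))

    private
      fresh : ∃[ κ ] κ ∉ all-forbidden K
      -- 1 + r (r + 1)^K is at most (r + 1)^K + r (r + 1)^K, which is `N`.
      fresh = ∉-exists (all-forbidden K)
        (≤-trans (s≤s (all-forbidden-length K)) (+-monoˡ-≤ (r * suc r ^ K) (m^n>0 (suc r) K)))

    κ : Fin N
    κ = proj₁ fresh

    κ-fresh : κ ∉ all-forbidden K
    κ-fresh = proj₂ fresh

    -- Otherwise an earlier separator of colour `κ` would be within 2Δ = K + 1 of y, and `κ` would
    -- be forbidden at distance `K`.
    far : ∀ {y u} → C y → C u → D y u ≤ Δ → ¬ Near Δ κ u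
    far cy cu d≤ near with _ , refl , m ← near⇒forbidden cy
                             (near-≤ (+-monoˡ-≤ Δ d≤) (near-dist cy cu near)) = κ-fresh m

    -- BFS paths to the root and their union.

    spine : ℕ → Fin n → List (Fin n)
    spine zero    c = c ∷ []
    spine (suc k) c = c ∷ spine k (par root c)

    spine-C : ∀ k {c x} → C c → lev c ≡ k → x ∈ spine k c → C x
    spine-C zero    cc eq (here refl) = cc
    spine-C (suc k) cc eq (here refl) = cc
    spine-C (suc k) cc eq (there m) with _ , cp , dp ← dist-suc root∈C cc eq = spine-C k cp dp m

    spine-lev : ∀ k {c x} → C c → lev c ≡ k → x ∈ spine k c → lev x ≤ k
    spine-lev zero    cc eq (here refl) = ≤-reflexive eq
    spine-lev (suc k) cc eq (here refl) = ≤-reflexive eq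
    spine-lev (suc k) cc eq (there m) with _ , cp , dp ← dist-suc root∈C cc eq =
      m≤n⇒m≤1+n (spine-lev k cp dp m)

    -- Each step to the parent lowers the level by one, so the tail stays strictly below its head.
    spine-unique : ∀ k {c x y} → C c → lev c ≡ k → x ∈ spine k c → y ∈ spine k c →
                   lev x ≡ lev y → x ≡ y
    spine-unique zero    cc eq (here refl) (here refl) _ = refl
    spine-unique (suc k) cc eq (here refl) (here refl) _ = refl
    spine-unique (suc k) cc eq (here refl) (there m) l with _ , cp , dp ← dist-suc root∈C cc eq =
      contradiction (subst (_≤ k) (trans (sym l) eq) (spine-lev k cp dp m)) (<⇒≱ ≤-refl)
    spine-unique (suc k) cc eq (there m) (here refl) l with _ , cp , dp ← dist-suc root∈C cc eq =
      contradiction (subst (_≤ k) (trans l eq) (spine-lev k cp dp m)) (<⇒≱ ≤-refl)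
    spine-unique (suc k) cc eq (there m) (there m′) l with _ , cp , dp ← dist-suc root∈C cc eq =
      spine-unique k cp dp m m′ l

    spine-start : ∀ k {c} → c ∈ spine k c
    spine-start zero    = here refl
    spine-start (suc k) = here refl

    spine-root : ∀ k {c} → C c → lev c ≡ k → root ∈ spine k c
    spine-root zero    cc eq = here (sym (dist-zero root∈C cc eq))
    spine-root (suc k) cc eq with _ , cp , dp ← dist-suc root∈C cc eq = there (spine-root k cp dp)

    spine-connected : ∀ {T : Fin n → Set} k {c x} → C c → lev c ≡ k →
      (∀ {z} → z ∈ spine k c → T z) → x ∈ spine k c → Star (Induced A T) c x
    spine-connected zero    cc eq t (here refl) = ε
    spine-connected (suc k) cc eq t (here refl) = ε
    spine-connected (suc k) cc eq t (there m) with e , cp , dp ← dist-suc root∈C cc eq =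
      (e , t (here refl) , t (there (spine-start k))) ◅ spine-connected k cp dp (t ∘ there) m

    tip : Fin r → Fin n
    tip i = proj₁ (target i)

    tip-C : ∀ i → C (tip i)
    tip-C i = proj₁ (proj₂ (target i))

    Spine : Fin r → List (Fin n)
    Spine i = spine (lev (tip i)) (tip i)

    H : Fin n → Set
    H x = ∃[ i ] x ∈ Spine i

    H? : ∀ x → Dec (H x)
    H? x = any? λ i → Any.any? (x ≟_) (Spine i)

    H⊆C : ∀ {x} → H x → C x
    H⊆C (i , m) = spine-C _ (tip-C i) refl m

    -- Every spine ends at the root; `new` supplies an index.
    root∈H : H root
    root∈H = new , spine-root _ (tip-C new) refl

    H-from-root : ∀ {x} → H x → Star (Induced A H) root x
    H-from-root (i , m) =
      reverse (within-sym H) (along (spine-root _ (tip-C i) refl)) ◅◅ along m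
      where
      along : ∀ {x} → x ∈ Spine i → Star (Induced A H) (tip i) x
      along = spine-connected _ (tip-C i) refl (i ,_)

    H-connected : ∀ {x y} → H x → H y → Star (Induced A H) x y
    H-connected hx hy = reverse (within-sym H) (H-from-root hx) ◅◅ H-from-root hy

    -- Components of the rest and the contracted bag.

    Rest : Fin n → Set
    Rest u = C u × ¬ H u

    Rest? : ∀ u → Dec (Rest u)
    Rest? u = C? u ×-dec ¬? (H? u)

    private
      components : ∃[ lab ] Labels (Induced A Rest) lab
      components = component-labels (λ x y → adj? x y ×-dec Rest? x ×-dec Rest? y)
                                    (within-sym Rest)

    component : Fin n → Fin n
    component = proj₁ components

    component-adj : ∀ {x y} → A x y → Rest x → Rest y → component x ≡ component y
    component-adj e rx ry = proj₁ (proj₂ components) (e , rx , ry)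

    φ₁ : Fin n → Maybe (Fin r)
    φ₁ v with H? v
    ... | yes _ = just new
    ... | no  _ = φ v

    φ₁-new : ∀ {v} → H v → φ₁ v ≡ just new
    φ₁-new {v} h with H? v
    ... | yes _ = refl
    ... | no ¬h = contradiction h ¬h

    φ₁-off : ∀ {v} → ¬ H v → φ₁ v ≡ φ v
    φ₁-off {v} ¬h with H? v
    ... | yes h = contradiction h ¬h
    ... | no _  = refl

    φ₁-old : ∀ {v i} → φ v ≡ just i → φ₁ v ≡ just i
    φ₁-old e = trans (φ₁-off λ h → contradiction (trans (sym e) (φ-C (H⊆C h))) λ ()) e

    φ₁-view : ∀ {v i} → φ₁ v ≡ just i → (H v × i ≡ new) ⊎ (φ v ≡ just i)
    φ₁-view {v} e with H? v
    ... | yes h = inj₁ (h , sym (just-injective e))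
    ... | no  _ = inj₂ e

    φ₁-connected : ∀ {u v i} → φ₁ u ≡ just i → φ₁ v ≡ just i →
                   Star (Induced A (λ x → φ₁ x ≡ just i)) u v
    φ₁-connected eu ev with φ₁-view eu | φ₁-view ev
    ... | inj₁ (hu , refl) | inj₁ (hv , _) =
      mapStar (λ (e , hx , hy) → e , φ₁-new hx , φ₁-new hy) (H-connected hu hv)
    ... | inj₁ (_ , refl) | inj₂ ov = contradiction ov new-free
    ... | inj₂ ou | inj₁ (_ , refl) = contradiction ou new-free
    ... | inj₂ ou | inj₂ ov =
      mapStar (λ (e , ox , oy) → e , φ₁-old ox , φ₁-old oy) (φ-connected ou ov)

    -- This is what the spines are for: the tip of the spine of `i` is a neighbour of bag `i`.
    new-joined : ∀ {i} → Bag i → ∃₂ λ a b → φ₁ a ≡ just i × φ₁ b ≡ just new × A a b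
    new-joined {i} bag with b , eb , e ← proj₂ (proj₂ (target i)) bag =
      b , tip i , φ₁-old eb , φ₁-new (i , spine-start _) , e

    φ₁-joined : ∀ {u v i j} → φ₁ u ≡ just i → φ₁ v ≡ just j → i ≢ j →
                ∃₂ λ a b → φ₁ a ≡ just i × φ₁ b ≡ just j × A a b
    φ₁-joined eu ev i≢j with φ₁-view eu | φ₁-view ev
    ... | inj₁ (_ , refl) | inj₁ (_ , refl) = contradiction refl i≢j
    ... | inj₁ (_ , refl) | inj₂ ov with b , a , eb , ea , e ← new-joined (_ , ov) =
      a , b , ea , eb , A-sym e
    ... | inj₂ ou | inj₁ (_ , refl) = new-joined (_ , ou)
    ... | inj₂ ou | inj₂ ov with a , b , ea , eb , e ← φ-joined ou ov i≢j =
      a , b , φ₁-old ea , φ₁-old eb , e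

    -- Distances to H are taken in the region `C` in which H was chosen, since the balls around its
    -- vertices live there, and not in the parts that remain.
    NearH : ℕ → Fin n → Set
    NearH k x = C x × ∃[ h ] (H h × D h x ≤ k)

    Near₁ : ℕ → Fin N → Fin n → Set
    Near₁ k κ′ x = Near k κ′ x ⊎ (κ′ ≡ κ × NearH k x)

    -- On H the colour `κ` is near at distance 0, and older colours at distance k + 1 come from bags
    -- at distance k. The length is at most 1 + r (r + 1)^k, hence at most (r + 1)^(k + 1).
    forbidden-new : ℕ → List (Fin N)
    forbidden-new zero    = κ ∷ []
    forbidden-new (suc k) = κ ∷ all-forbidden k

    forbidden₁ : Fin r → ℕ → List (Fin N)
    forbidden₁ i k with i ≟ new
    ... | yes _ = forbidden-new k
    ... | no  _ = forbidden i k

    forbidden₁-length : ∀ i k → length (forbidden₁ i k) ≤ suc r ^ k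
    forbidden₁-length i k with i ≟ new
    ... | no _ = forbidden-length i k
    forbidden₁-length i zero    | yes _ = ≤-refl
    forbidden₁-length i (suc k) | yes _ = +-mono-≤ (m^n>0 (suc r) k) (all-forbidden-length k)

    κ∈forbidden-new : ∀ k → κ ∈ forbidden-new k
    κ∈forbidden-new zero    = here refl
    κ∈forbidden-new (suc k) = here refl

    forbidden₁-near : ∀ {b i k κ′} → φ₁ b ≡ just i → Near₁ k κ′ b → κ′ ∈ forbidden₁ i k
    forbidden₁-near {i = i} eb near with φ₁-view eb | i ≟ new
    forbidden₁-near {k = k} eb (inj₂ (refl , _)) | _ | yes _ = κ∈forbidden-new k
    forbidden₁-near eb (inj₁ near) | inj₁ (h , _) | yes _
      with _ , refl , m ← near⇒forbidden (H⊆C h) near = there m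
    forbidden₁-near eb near | inj₁ (_ , p) | no q = contradiction p q
    forbidden₁-near eb near | inj₂ ob | yes refl = contradiction ob new-free
    forbidden₁-near eb (inj₁ near) | inj₂ ob | no _ = forbidden-near ob near
    -- Old bags lie outside `C`, where `NearH` never holds, so `κ` need not enter their lists.
    forbidden₁-near eb (inj₂ (_ , cb , _)) | inj₂ ob | no _ =
      contradiction (trans (sym ob) (φ-C cb)) λ ()

    near₁-mono : ∀ {k κ′ x} → Near₁ k κ′ x → Near₁ (suc k) κ′ x
    near₁-mono (inj₁ near)               = inj₁ (near-mono near)
    near₁-mono (inj₂ (e , c , h , hh , d)) = inj₂ (e , c , h , hh , m≤n⇒m≤1+n d)

    near₁-step : ∀ {k κ′ x} → Rest x → Near₁ k κ′ x →
                 ∃[ j ] (k ≡ suc j × ∃[ y ] (A x y × Near₁ j κ′ y))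
    near₁-step (cx , _) (inj₁ near) with j , eq , y , e , near′ ← near-step cx near =
      j , eq , y , e , inj₁ near′
    near₁-step {k} {x = x} (cx , ¬hx) (inj₂ (refl , _ , h , hh , d≤)) = go (D h x) refl d≤
      where
      go : ∀ m {k} → D h x ≡ m → m ≤ k → ∃[ j ] (k ≡ suc j × ∃[ y ] (A x y × Near₁ j κ y))
      go zero eq _ = contradiction (subst H (sym (dist-zero (H⊆C hh) cx eq)) hh) ¬hx
      go (suc m) {suc k} eq (s≤s m≤k) with e , cv , dv ← dist-suc (H⊆C hh) cx eq =
        k , refl , par h x , e , inj₂ (refl , cv , h , hh , ≤-trans (≤-reflexive dv) m≤k)

    near₁-lip : ∀ {k κ′ x y} → C x → C y → A x y → Near₁ k κ′ x → Near₁ (suc k) κ′ y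
    near₁-lip cx cy e (inj₁ near) = inj₁ (near-lip cx cy e near)
    near₁-lip cx cy e (inj₂ (eq , _ , h , hh , d≤)) =
      inj₂ (eq , cy , h , hh , ≤-trans (dist-lip (H⊆C hh) cy cx (A-sym e)) (s≤s d≤))

    -- Bags with no neighbour in the part are forgotten, so that their indices can be reused.
    module _ (w : Fin n) where

      Part : Fin n → Set
      Part u = Rest u × component u ≡ w

      Part? : ∀ u → Dec (Part u)
      Part? u = Rest? u ×-dec component u ≟ w

      Touches : Fin r → Set
      Touches i = ∃₂ λ b c → φ₁ b ≡ just i × Part c × A b c

      touches? : ∀ i → Dec (Touches i)
      touches? i = any? λ b → any? λ c → ≡-dec _≟_ (φ₁ b) (just i) ×-dec Part? c ×-dec adj? b c

      restrict : Maybe (Fin r) → Maybe (Fin r)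
      restrict nothing = nothing
      restrict (just i) with touches? i
      ... | yes _ = just i
      ... | no  _ = nothing

      restrict-view : ∀ m {i} → restrict m ≡ just i → m ≡ just i × Touches i
      restrict-view (just i) e with touches? i
      restrict-view (just i) refl | yes t = refl , t

      restrict-keeps : ∀ {m i} → m ≡ just i → Touches i → restrict m ≡ just i
      restrict-keeps {i = i} refl t with touches? i
      ... | yes _ = refl
      ... | no ¬t = contradiction t ¬t

      part-connected : ∀ {u v} → Part u → Part v → Star (Induced A Part) u v
      part-connected (_ , refl) (_ , eq) = lift refl (proj₂ (proj₂ components) (sym eq))
        where
        lift : ∀ {u v} → component u ≡ w → Star (Induced A Rest) u v → Star (Induced A Part) u v
        lift _ ε = ε
        lift cu ((e , ru , rx) ◅ es) =
          let cx = trans (sym (component-adj e ru rx)) cu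
          in (e , (ru , cu) , (rx , cx)) ◅ lift cx es

      -- A neighbour outside the part is in an old bag if it is outside `C`, and in the new bag if
      -- it is in H; in `Rest` it would have the same component.
      part-boundary : ∀ {c y} → Part c → ¬ Part y → A c y → ∃[ i ] restrict (φ₁ y) ≡ just i
      part-boundary {c} {y} pc@(rc@(cc , _) , eq) ¬py e = decide (C? y) (H? y)
        where
        touched : ∀ {i} → φ₁ y ≡ just i → ∃[ i ] restrict (φ₁ y) ≡ just i
        touched ei = _ , restrict-keeps ei (y , c , ei , pc , A-sym e)
        decide : Dec (C y) → Dec (H y) → ∃[ i ] restrict (φ₁ y) ≡ just i
        decide (no ¬cy) _         = touched (φ₁-old (proj₂ (φ-boundary cc ¬cy e)))
        decide (yes _) (yes hy)   = touched (φ₁-new hy)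
        decide (yes cy) (no ¬hy) =
          contradiction ((cy , ¬hy) , trans (sym (component-adj e rc (cy , ¬hy))) eq) ¬py

      child : State
      child = record
        { C = Part
        ; C? = Part?
        ; connected = part-connected
        ; φ = restrict ∘ φ₁
        ; φ-C = λ {u} ((cu , ¬hu) , _) → cong restrict (trans (φ₁-off ¬hu) (φ-C cu))
        ; φ-touch = λ {v} e →
            let _ , t@(b , c , eb , pc , bc) = restrict-view (φ₁ v) e
            in b , c , restrict-keeps eb t , pc , bc
        ; φ-connected = λ {u} {v} eu ev →
            let eu′ , t = restrict-view (φ₁ u) eu
                ev′ , _ = restrict-view (φ₁ v) ev
            in mapStar (λ (e , ex , ey) → e , restrict-keeps ex t , restrict-keeps ey t)
                       (φ₁-connected eu′ ev′)
        ; φ-joined = λ {u} {v} eu ev i≢j →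
            let eu′ , t  = restrict-view (φ₁ u) eu
                ev′ , t′ = restrict-view (φ₁ v) ev
                a , b , ea , eb , e = φ₁-joined eu′ ev′ i≢j
            in a , b , restrict-keeps ea t , restrict-keeps eb t′ , e
        ; φ-boundary = part-boundary
        ; Near = Near₁
        ; near-mono = near₁-mono
        ; near-step = λ (rx , _) → near₁-step rx
        ; near-lip = λ ((cx , _) , _) ((cy , _) , _) → near₁-lip cx cy
        ; forbidden = forbidden₁
        ; forbidden-near = λ {b} e → forbidden₁-near (proj₁ (restrict-view (φ₁ b) e))
        ; forbidden-length = forbidden₁-length
        }

    -- A spine has one vertex per level, so two centres of the same colour differ by at least
    -- 2Δ + 1 levels and their balls of radius Δ are disjoint.
    Center : Color → Fin n → Set
    Center (κ′ , i , m) y = κ′ ≡ κ × y ∈ Spine i × toℕ m ≡ lev y % suc (Δ + Δ)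

    Claims : Color → Fin n → Fin n → Set
    Claims γ y u = Center γ y × C u × D y u ≤ Δ

    claims? : ∀ γ y u → Dec (Claims γ y u)
    claims? (κ′ , i , m) y u =
      (κ′ ≟ κ ×-dec Any.any? (y ≟_) (Spine i) ×-dec toℕ m ℕ.≟ lev y % suc (Δ + Δ))
      ×-dec C? u ×-dec D y u ≤? Δ

    center-H : ∀ {γ y} → Center γ y → H y
    center-H (_ , m , _) = _ , m

    center-C : ∀ {γ y} → Center γ y → C y
    center-C c = H⊆C (center-H c)

    claims-unique : ∀ {γ y y′ u} → Claims γ y u → Claims γ y′ u → y ≡ y′
    claims-unique {_ , i , _} {y} {y′} {u} (c@(_ , m , e) , cu , d) (c′@(_ , m′ , e′) , _ , d′) =
      spine-unique _ (tip-C i) refl m m′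
        (%≡∧close⇒≡ (Δ + Δ) (trans (sym e) e′) (close (center-C c) (center-C c′) cu d d′)
          (close (center-C c′) (center-C c) cu d′ d))
      where
      -- Levels change by at most one per edge, so both centres are within Δ levels of the common
      -- vertex u.
      close : ∀ {y y′ u} → C y → C y′ → C u → D y u ≤ Δ → D y′ u ≤ Δ → lev y ≤ Δ + Δ + lev y′
      close {y} {y′} {u} cy cy′ cu d d′ = begin
        lev y                      ≤⟨ lev-lower cy cu ⟩
        D y u + lev u              ≤⟨ +-mono-≤ d (lev-upper cy′ cu) ⟩
        Δ + (D y′ u + lev y′)      ≤⟨ +-monoʳ-≤ Δ (+-monoˡ-≤ (lev y′) d′) ⟩
        Δ + (Δ + lev y′)           ≡⟨ +-assoc Δ Δ (lev y′) ⟨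
        Δ + Δ + lev y′             ∎
        where open ≤-Reasoning

    Claimed : Color → Fin n → Set
    Claimed γ u = ∃[ y ] Claims γ y u

    claimed? : ∀ γ u → Dec (Claimed γ u)
    claimed? γ u = any? λ y → claims? γ y u

    -- With `claimed⇒far`, this separates the generations: claimed vertices are near the new
    -- separator, hence avoided by the forests of the parts, and far from equally coloured earlier
    -- separators.
    claimed⇒near : ∀ {γ u} → Claimed γ u → Near₁ Δ (proj₁ γ) u
    claimed⇒near (y , c@(eq , _) , cu , d) = inj₂ (eq , cu , y , center-H c , d)

    claimed⇒far : ∀ {γ u} → Claimed γ u → ¬ Near Δ (proj₁ γ) u
    claimed⇒far (y , c@(refl , _) , cu , d) = far (center-C c) cu d

    ClaimStep : Color → Rel₀ (Fin n)
    ClaimStep γ u v = ∃[ y ] (Claims γ y u × D y u ≢ 0 × v ≡ par y u)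

    claimStep? : ∀ γ → Decidable (ClaimStep γ)
    claimStep? γ u v = any? λ y → claims? γ y u ×-dec ¬? (D y u ℕ.≟ 0) ×-dec v ≟ par y u

    claims-parent : ∀ {γ y u} → Claims γ y u → D y u ≢ 0 →
                    A u (par y u) × Claims γ y (par y u) × suc (D y (par y u)) ≡ D y u
    claims-parent {γ} {y} {u} (c , cu , d) d≢0 = go (D y u) refl
      where
      go : ∀ m → D y u ≡ m → A u (par y u) × Claims γ y (par y u) × suc (D y (par y u)) ≡ D y u
      go zero    eq = contradiction eq d≢0
      go (suc m) eq with e , cv , dv ← dist-suc (center-C c) cu eq =
        e , (c , cv , ≤-trans (n≤1+n _) (≤-trans (≤-reflexive drop) d)) , drop
        where
        drop : suc (D y (par y u)) ≡ D y u
        drop = trans (cong suc dv) (sym eq)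

    -- The path is cut at its first vertex in H; if there is none, it survives in `Rest`.
    split : ∀ d {u v} → C u → Path (Induced A C) d u v →
      (∃[ y ] (H y × ∃₂ λ a b → Path (Induced A C) a u y × Path (Induced A C) b y v × a + b ≡ d))
      ⊎ (Rest u × Path (Induced A Rest) d u v)
    split d {u} cu p with H? u
    ... | yes hu = inj₁ (u , hu , 0 , d , refl , p , refl)
    split zero cu refl | no ¬hu = inj₂ ((cu , ¬hu) , refl)
    split (suc d) cu (x , e@(ux , _ , cx) , p) | no ¬hu with split d cx p
    ... | inj₁ (y , hy , a , b , pa , pb , eq) =
      inj₁ (y , hy , suc a , b , (x , e , pa) , pb , cong suc eq)
    ... | inj₂ (rx , q) = inj₂ ((cu , ¬hu) , x , (ux , (cu , ¬hu) , rx) , q)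

    rest⇒part : ∀ d {w u v} → component u ≡ w → Path (Induced A Rest) d u v →
                Path (Induced A (Part w)) d u v
    rest⇒part zero    _  p = p
    rest⇒part (suc d) cu (x , (e , ru , rx) , p) =
      let cx = trans (sym (component-adj e ru rx)) cu
      in x , (e , (ru , cu) , (rx , cx)) , rest⇒part d cx p

    -- Gluing the new balls to the covers of the parts.

    module _ (sub : ∀ w → Cover (child w)) where
      private module Sub (w : Fin n) = Cover (sub w)

      SubParent : Color → Rel₀ (Fin n)
      SubParent γ u v = ¬ Claimed γ u × Sub.Parent (component u) γ u v

      Parent : Color → Rel₀ (Fin n)
      Parent γ u v = ClaimStep γ u v ⊎ SubParent γ u v

      parent? : ∀ γ → Decidable (Parent γ)
      parent? γ u v =
        claimStep? γ u v ⊎-dec (¬? (claimed? γ u) ×-dec Sub.parent? (component u) γ u v)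

      functional : ∀ {γ u v v′} → Parent γ u v → Parent γ u v′ → v ≡ v′
      functional (inj₁ (y , c , _ , refl)) (inj₁ (y′ , c′ , _ , refl)) =
        cong (λ y → par y _) (claims-unique c c′)
      functional (inj₁ (y , c , _)) (inj₂ (¬c , _)) = contradiction (y , c) ¬c
      functional (inj₂ (¬c , _)) (inj₁ (y , c , _)) = contradiction (y , c) ¬c
      functional {u = u} (inj₂ (_ , p)) (inj₂ (_ , p′)) = Sub.functional (component u) p p′

      sub-unclaimed : ∀ w {γ u v} → Sub.Parent w γ u v → ¬ Claimed γ u × ¬ Claimed γ v
      sub-unclaimed w p with fu , fv ← Sub.parent-far w p = fu ∘ claimed⇒near , fv ∘ claimed⇒near

      acc-claimed : ∀ γ y m {u} → Claims γ y u → D y u ≡ m → Acc (flip (Parent γ)) u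
      acc-claimed γ y m {u} c eq = acc (next m eq)
        where
        next : ∀ m → D y u ≡ m → ∀ {v} → Parent γ u v → Acc (flip (Parent γ)) v
        next m eq (inj₂ (¬c , _)) = contradiction (y , c) ¬c
        next m eq (inj₁ (y′ , c′ , d≢0 , refl)) with refl ← claims-unique c c′
          with m
        ... | zero  = contradiction eq d≢0
        ... | suc m with _ , cv , drop ← claims-parent c d≢0 =
          acc-claimed γ y m cv (suc-injective (trans drop eq))

      acc-sub : ∀ γ w {u} → Acc (flip (Sub.Parent w γ)) u → ¬ Claimed γ u → component u ≡ w →
                Acc (flip (Parent γ)) u
      acc-sub γ w (acc rs) ¬c refl = acc λ where
        (inj₁ (y , c , _)) → contradiction (y , c) ¬c
        (inj₂ (_ , p)) → acc-sub γ w (rs p) (proj₂ (sub-unclaimed w p))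
                           (proj₂ (proj₂ (Sub.parent-C w p)))

      -- From a claimed vertex the distance to its centre decreases; from an unclaimed one the steps
      -- follow the forest of its part and never enter a claimed ball.
      well-founded : ∀ γ u → Acc (flip (Parent γ)) u
      well-founded γ u with claimed? γ u
      ... | yes (y , c) = acc-claimed γ y _ c refl
      ... | no ¬c = acc-sub γ _ (Sub.well-founded (component u) γ u) ¬c refl

      parent-adj : ∀ {γ u v} → Parent γ u v → A u v
      parent-adj (inj₁ (y , c , d≢0 , refl)) = proj₁ (claims-parent c d≢0)
      parent-adj {u = u} (inj₂ (_ , p)) = Sub.parent-adj (component u) p

      parent-C : ∀ {γ u v} → Parent γ u v → C u × C v
      parent-C (inj₁ (y , c@(_ , cu , _) , d≢0 , refl))
        with _ , (_ , cv , _) , _ ← claims-parent c d≢0 = cu , cv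
      parent-C {u = u} (inj₂ (_ , p))
        with ((cu , _) , _) , ((cv , _) , _) ← Sub.parent-C (component u) p = cu , cv

      parent-far : ∀ {γ u v} → Parent γ u v → ¬ Near Δ (proj₁ γ) u × ¬ Near Δ (proj₁ γ) v
      parent-far (inj₁ (y , c , d≢0 , refl)) =
        claimed⇒far (y , c) , claimed⇒far (y , proj₁ (proj₂ (claims-parent c d≢0)))
      parent-far {u = u} (inj₂ (_ , p)) with fu , fv ← Sub.parent-far (component u) p =
        fu ∘ inj₁ , fv ∘ inj₁

      climb : ∀ γ y m {u} → Claims γ y u → D y u ≡ m → Path (Parent γ) m u y
      climb γ y zero    (c , cu , _) eq = dist-zero (center-C c) cu eq
      climb γ y (suc m) c eq with d≢0 ← (λ z → contradiction (trans (sym z) eq) λ ())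
        with _ , cv , drop ← claims-parent c d≢0 =
        par y _ , inj₁ (y , c , d≢0 , refl) , climb γ y m cv (suc-injective (trans drop eq))

      lift-path : ∀ w γ d {u v} → Path (Sub.Parent w γ) d u v → Path (Parent γ) d u v
      lift-path w γ zero    p = p
      lift-path w γ (suc d) (x , e , p) with (_ , refl) , _ ← Sub.parent-C w e =
        x , inj₂ (proj₁ (sub-unclaimed w e) , e) , lift-path w γ d p

      covers : ∀ {d u v} → C u → Path (Induced A C) d u v → d ≤ Δ → Meet Parent d u v
      covers {d} {u} {v} cu p d≤Δ with split d cu p
      ... | inj₂ (ru , q)
        with γ , x , a , b , pa , pb , a+b≤d ← Sub.covers (component u) (ru , refl) (rest⇒part d refl q) d≤Δ =
        γ , x , a , b , lift-path _ γ a pa , lift-path _ γ b pb , a+b≤d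
      -- The path passes through y in H. Both ends lie in the ball of radius Δ around y, and
      -- climbing to y costs no more than the two pieces of the path.
      ... | inj₁ (y , hy@(i , m) , a , b , pa , pb , refl) =
        γ , y , D y u , D y v , climb γ y _ (center , cu , ≤-trans du a≤) refl ,
        climb γ y _ (center , cv , ≤-trans dv b≤) refl , +-mono-≤ du dv
        where
        cy : C y
        cy = H⊆C hy
        end∈C : ∀ b {y v} → C y → Path (Induced A C) b y v → C v
        end∈C zero    cy refl = cy
        end∈C (suc b) cy (_ , (_ , _ , cx) , p) = end∈C b cx p
        cv : C v
        cv = end∈C b cy pb
        γ : Color
        γ = κ , i , lev y mod suc (Δ + Δ)
        center : Center γ y
        center = refl , m , toℕ-fromℕ< (m%n<n (lev y) (suc (Δ + Δ)))
        du : D y u ≤ a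
        du = dist≤path cy a cu pa
        dv : D y v ≤ b
        dv = dist≤path cy b cv (path-reverse (within-sym C) b pb)
        a≤ : a ≤ Δ
        a≤ = ≤-trans (m≤m+n a b) d≤Δ
        b≤ : b ≤ Δ
        b≤ = ≤-trans (m≤n+m b a) d≤Δ

      cover : Cover S
      cover = record
        { Parent = Parent ; parent? = parent? ; functional = functional
        ; well-founded = well-founded ; parent-adj = parent-adj ; parent-C = parent-C
        ; parent-far = parent-far ; covers = covers }

  -- The list xs ⊇ C loses the root at each level, which bounds the recursion depth.
  solve : ∀ m xs → length xs ≤ m → (S : State) → (∀ {u} → State.C S u → u ∈ xs) → Cover S
  solve m xs len S C⊆xs with any? (State.C? S)
  ... | no empty = record
    { Parent = λ _ _ _ → ⊥ ; parent? = λ _ _ _ → no id ; functional = λ ()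
    ; well-founded = λ _ _ → acc λ () ; parent-adj = λ () ; parent-C = λ ()
    ; parent-far = λ () ; covers = λ cu → contradiction (_ , cu) empty }
  solve zero [] len S C⊆xs | yes (root , c) with () ← C⊆xs c
  solve (suc m) xs len S C⊆xs | yes (root , c) =
    Step.cover S c λ w → solve m (filter other? xs)
      (≤-pred (≤-trans (filter-notAll other? xs (Any.map (λ eq ne → ne (sym eq)) (C⊆xs c))) len))
      (Step.child S c w)
      -- The root is in H, which every part avoids, so removing it from the list loses no vertex of
      -- the part.
      λ ((cu , ¬hu) , _) → ∈-filter⁺ other? (C⊆xs cu) λ { refl → ¬hu (Step.root∈H S c) }
    where
    other? : ∀ x → Dec (x ≢ root)
    other? x = ¬? (x ≟ root)

-- From parent forests to spanning trees.

module Bounded {n : ℕ} (G : Graph n) {Δ : ℕ} (diam : Diameter G Δ) where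

  shortest-path : ∀ u v → ∃[ d ] (Dist (Adj G) u v d × Path (Adj G) d u v × d ≤ Δ)
  shortest-path u v with d , dist@(walk , _) , d≤ ← proj₁ diam u v =
    d , dist , walk⇒path′ walk , d≤

  -- `Adj` is an arbitrary family of types; the distances supplied by the diameter decide it, as
  -- adjacent means at distance 1.
  adj? : Decidable (Adj G)
  adj? u v with shortest-path u v
  ... | 0 , _ , refl , _ = no (adj-irr G u)
  ... | 1 , _ , (_ , e , refl) , _ = yes e
  ... | suc (suc _) , (_ , min) , _ = no λ e →
    contradiction (min 1 (path⇒walk 1 (v , e , refl))) λ { (s≤s ()) }

  connected : ∀ u v → Star (Adj G) u v
  connected u v with d , _ , p , _ ← shortest-path u v = path⇒star d p

  -- The greedy pass starts from the parent forest and so keeps its edges; as G is connected, one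
  -- component results.
  spanningTree : ∀ {P : Rel₀ (Fin n)} → (∀ {u v v′} → P u v → P u v′ → v ≡ v′) →
    (∀ u → Acc (flip P) u) → Decidable P → (∀ {u v} → P u v → Adj G u v) →
    ∃[ T ] (∀ {u v} → P u v → E {G = G} T u v)
  spanningTree functional wf P? P⇒A
    with F , extends , all-same ← spanning adj? (adj-sym G)
           (parentForest functional wf P? (adj-sym G) P⇒A) = record
    { V = λ _ → ⊤ ; E = Edge F ; E⊆G = edge-R F ; E-sym = edge-sym F ; E-V = λ _ → tt
    ; conn = λ u v _ _ →
        let k , p = star⇒path (proj₂ (labels F) (same-label F all-same (connected u v)))
        in k , path⇒walk k p
    ; acyclic = bridges⇒acyclic (bridges F) (edge-sym F) } , λ p → extends (inj₁ p)
    where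
    open Forest
    same-label : ∀ F → (∀ {x y} → Adj G x y → lab F x ≡ lab F y) →
                 ∀ {x y} → Star (Adj G) x y → lab F x ≡ lab F y
    same-label F s ε        = refl
    same-label F s (e ◅ es) = trans (s e) (same-label F s es)

  -- Walks in `T` are walks in G, so none is shorter than `d`.
  tree-dist : ∀ (T : SubTree G) {u v d k} → Dist (Adj G) u v d → Path (E T) k u v → k ≤ d →
              Dist (E T) u v d
  tree-dist T {u} {v} {d} {k} (_ , min) p k≤d =
    subst (Walk (E T) u v) (≤-antisym k≤d (shorter (path⇒walk k p))) (path⇒walk k p) ,
    λ _ → shorter
    where
    shorter : ∀ {m} → Walk (E T) u v m → d ≤ m
    shorter (w , steps , ends) = min _ (w , E⊆G T ∘ steps , ends)

-- The number of colours.

1+n≤2^n : ∀ n → suc n ≤ 2 ^ n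
1+n≤2^n zero    = ≤-refl
1+n≤2^n (suc n) = +-mono-≤ (m^n>0 2 n) (≤-trans (1+n≤2^n n) (m≤m+n (2 ^ n) 0))

-- By 1 + n ≤ 2^n the factors are at most 2 to the powers 2rΔ, rΔ and 2Δ, whence the constant 3r +
-- 2.
colors-bound : ∀ r δ → let Δ = suc δ in
  suc r ^ (Δ + Δ) * (r * suc (Δ + Δ)) ≤ 2 ^ ((3 * r + 2) * Δ)
colors-bound r δ = begin
  suc r ^ (Δ + Δ) * (r * suc (Δ + Δ))
    ≤⟨ *-mono-≤ (^-monoˡ-≤ (Δ + Δ) (1+n≤2^n r)) (*-mono-≤ r≤ (1+n≤2^n (Δ + Δ))) ⟩
  (2 ^ r) ^ (Δ + Δ) * (2 ^ (r * Δ) * 2 ^ (Δ + Δ))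
    ≡⟨ cong₂ _*_ (^-*-assoc 2 r (Δ + Δ)) (sym (^-distribˡ-+-* 2 (r * Δ) (Δ + Δ))) ⟩
  2 ^ (r * (Δ + Δ)) * 2 ^ (r * Δ + (Δ + Δ))
    ≡⟨ ^-distribˡ-+-* 2 (r * (Δ + Δ)) (r * Δ + (Δ + Δ)) ⟨
  2 ^ (r * (Δ + Δ) + (r * Δ + (Δ + Δ)))
    ≡⟨ cong (2 ^_) (solve 2 (λ r Δ → r :* (Δ :+ Δ) :+ (r :* Δ :+ (Δ :+ Δ)) :=
                                     (con 3 :* r :+ con 2) :* Δ) refl r Δ) ⟩
  2 ^ ((3 * r + 2) * Δ) ∎
  where
  open ≤-Reasoning
  open +-*-Solver
  Δ = suc δ
  r≤ : r ≤ 2 ^ (r * Δ)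
  r≤ = ≤-trans (n≤1+n r) (≤-trans (1+n≤2^n r) (^-monoʳ-≤ 2 (m≤m*n r Δ)))

theorem1p4 : ∀ (r : ℕ) → ∃[ c ] (∀ (n : ℕ) (G : Graph n) (Δ : ℕ) →
    KMinorFree G r → Diameter G Δ →
    ∃[ m ] (m ≤ 2 ^ (c * Δ) × Σ (Fin m → SubTree G) λ F →
    ∀ u v → ∃[ i ] ∃[ d ] (Dist (E (F i)) u v d × Dist (Adj G) u v d)))
theorem1p4 r = 3 * r + 2 , cover
  where
  cover : ∀ (n : ℕ) (G : Graph n) (Δ : ℕ) → KMinorFree G r → Diameter G Δ →
    ∃[ m ] (m ≤ 2 ^ ((3 * r + 2) * Δ) × Σ (Fin m → SubTree G) λ F →
    ∀ u v → ∃[ i ] ∃[ d ] (Dist (E (F i)) u v d × Dist (Adj G) u v d))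
  -- The bound allows 2^0 = 1 tree, and all vertices coincide, so any spanning tree will do.
  cover n G zero minor-free diam =
    1 , ≤-reflexive (cong (2 ^_) (sym (*-zeroʳ (3 * r + 2)))) , (λ _ → tree) , λ u v → exact u v
    where
    open Bounded G diam
    tree : SubTree G
    tree = proj₁ (spanningTree {P = λ _ _ → ⊥} (λ ()) (λ _ → acc λ ()) (λ _ _ → no id) λ ())
    exact : ∀ u v → Σ (Fin 1) λ _ → ∃[ d ] (Dist (E tree) u v d × Dist (Adj G) u v d)
    exact u v with 0 , dist , refl , _ ← shortest-path u v =
      zero , 0 , tree-dist tree dist refl z≤n , dist
  cover n G (suc δ) minor-free diam =
    N * (r * suc (Δ + Δ)) , colors-bound r δ , proj₁ ∘ tree ∘ decode , exact
    where
    open Bounded G diam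
    open Clustering G adj? r minor-free δ
    -- The whole graph, before any separator has been chosen.
    start : State
    start = record
      { C = λ _ → ⊤ ; C? = λ _ → yes tt
      ; connected = λ {u} {v} _ _ → mapStar (λ e → e , tt , tt) (connected u v)
      ; φ = λ _ → nothing ; φ-C = λ _ → refl ; φ-touch = λ () ; φ-connected = λ ()
      ; φ-joined = λ () ; φ-boundary = λ _ ¬c → contradiction tt ¬c
      ; Near = λ _ _ _ → ⊥ ; near-mono = λ () ; near-step = λ _ () ; near-lip = λ _ _ _ ()
      ; forbidden = λ _ _ → [] ; forbidden-near = λ () ; forbidden-length = λ _ _ → z≤n }
    open Cover (solve _ (allFin n) ≤-refl start (λ _ → ∈-allFin _))
    tree : ∀ γ → ∃[ T ] (∀ {u v} → Parent γ u v → E {G = G} T u v)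
    tree γ = spanningTree functional (well-founded γ) (parent? γ) parent-adj
    decode : Fin (N * (r * suc (Δ + Δ))) → Color
    decode = map₂ (remQuot _) ∘ remQuot {N} _
    encode : Color → Fin (N * (r * suc (Δ + Δ)))
    encode (κ , i , m) = combine κ (combine i m)
    decode-encode : ∀ γ → decode (encode γ) ≡ γ
    decode-encode (κ , i , m) =
      trans (cong (map₂ (remQuot _)) (remQuot-combine κ (combine i m)))
            (cong (κ ,_) (remQuot-combine i m))
    exact : ∀ u v → ∃[ i ] ∃[ d ]
      (Dist (E (proj₁ (tree (decode i)))) u v d × Dist (Adj G) u v d)
    exact u v with d , dist , p , d≤Δ ← shortest-path u v
      with γ , x , a , b , pa , pb , a+b≤d ←
        covers tt (path-map (λ e → e , tt , tt) d p) d≤Δ =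
      encode γ , d ,
      -- The two climbs, joined at x, form a walk of length a + b in `T`.
      subst (λ γ → Dist (E (proj₁ (tree γ))) u v d) (sym (decode-encode γ))
        (tree-dist T dist (path-++ a (path-map include a pa)
          (path-reverse (E-sym T) b (path-map include b pb))) a+b≤d) ,
      dist
      where
      T : SubTree G
      T = proj₁ (tree γ)
      include : ∀ {u v} → Parent γ u v → E T u v
      include = proj₂ (tree γ)
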